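{- Let $f=\mathrm{Per}_n+\sum_{i,j=1}^n x_{i,j}$, a polynomial in the $n^2$ variables $x_{i,j}$, $1\le i,j\le n$, where $\mathrm{Per}_n(x)=\sum_{h}\prod_{i=1}^n x_{i,h(i)}$ with the sum over all permutations $h$ of $\{1,\ldots,n\}$. Then $\mathrm{D}(f)\leq n^{2}$ but $\mathrm{C}_{0/1}(f)=2^{\Omega(n)}$.
   Context: All polynomials have nonnegative integer coefficients. A $\{+,\times\}$-circuit is a directed acyclic graph whose input nodes (fanin $0$) are labelled by variables and whose other nodes, called gates, have fanin two and are labelled $+$ or $\times$; its size is the number of gates. Syntactically (formally, expanding by distributivity) the circuit produces at each node a polynomial: the variable itself at an input, and the sum (product) of the polynomials produced at its two inputs at a $+$ ($\times$) gate. The polynomial $F$ produced by the circuit is the one produced at its output. For a polynomial $f$ in $N$ variables, the circuit counts $f$ if $F(a)=f(a)$ for all $a\in\{0,1\}^N$, and decides $f$ if for all $a\in\{0,1\}^N$, $F(a)=0$ holds exactly when $f(a)=0$. $\mathrm{C}_{0/1}(f)$ and $\mathrm{D}(f)$ denote the minimum sizes of a $\{+,\times\}$-circuit counting $f$, respectively deciding $f$. -}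

module Defs where

open import Data.Bool.Base using (Bool; if_then_else_)
open import Data.Fin.Base using (Fin; combine)
open import Data.Fin.Properties using (_≟_; all?; any?)
open import Data.List.Base as List using (List; []; _∷_; _++_)
open import Data.Nat.Base using (ℕ; zero; suc; _+_; _*_; _^_; _≤_; NonZero)
open import Data.Nat.ListAction using (sum)
open import Data.Product.Base using (_×_; ∃-syntax)
open import Data.Vec.Base as Vec using (Vec; []; _∷_; lookup)
open import Function.Bundles using (_⇔_)
open import Function.Consequences.Propositional using (strictlySurjective⇒surjective; surjective⇒strictlySurjective)
open import Function.Definitions using (Injective; Surjective; Bijective)
open import Relation.Binary.PropositionalEquality using (_≡_)
open import Relation.Nullary.Decidable using (Dec; map′; _×-dec_; _→-dec_)

-- The vector of exponents.
Monomial : ℕ → Set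
Monomial N = Vec ℕ N

-- A polynomial is a formal sum of monomials: the coefficient of a monomial
-- is its number of occurrences in the list.
Poly : ℕ → Set
Poly N = List (Monomial N)

module _ {N : ℕ} where

  infixl 6 _⊕_
  infixl 7 _⊗_

  var : Fin N → Poly N
  var i = List.[ Vec.replicate N 0 Vec.[ i ]≔ 1 ]

  𝟘 𝟙 : Poly N
  𝟘 = []
  𝟙 = List.[ Vec.replicate N 0 ]

  _⊕_ _⊗_ : Poly N → Poly N → Poly N
  p ⊕ q = p ++ q
  p ⊗ q = List.cartesianProductWith (Vec.zipWith _+_) p q

  ∑ ∏ : {A : Set} → List A → (A → Poly N) → Poly N
  ∑ xs t = List.foldr (λ x → t x ⊕_) 𝟘 xs
  ∏ xs t = List.foldr (λ x → t x ⊗_) 𝟙 xs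

  evalMonomial : Monomial N → Vec ℕ N → ℕ
  evalMonomial e a = Vec.foldr′ _*_ 1 (Vec.zipWith _^_ a e)

  eval : Poly N → Vec ℕ N → ℕ
  eval p a = sum (List.map (λ e → evalMonomial e a) p)

bit : Bool → ℕ
bit b = if b then 1 else 0

_at_ : ∀ {N} → Poly N → Vec Bool N → ℕ
p at a = eval p (Vec.map bit a)

data Op : Set where
  plus times : Op

-- The Fin k are references to k earlier nodes; the two inputs of a gate may
-- coincide.
data Node (N k : ℕ) : Set where
  input : Fin N → Node N k
  gate  : Op → Fin k → Fin k → Node N k

-- Acyclicity is expressed by listing the nodes in topological order, the
-- newest node first: a node refers only to nodes behind it in the list.
data DAG (N : ℕ) : ℕ → Set where
  []  : DAG N 0
  _∷_ : ∀ {k} → Node N k → DAG N k → DAG N (suc k)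

record Circuit (N : ℕ) : Set where
  constructor circuit
  field
    {nodes} : ℕ
    dag     : DAG N nodes
    output  : Fin nodes

⟦_⟧op : ∀ {N} → Op → Poly N → Poly N → Poly N
⟦ plus  ⟧op = _⊕_
⟦ times ⟧op = _⊗_

nodePoly : ∀ {N k} → Node N k → Vec (Poly N) k → Poly N
nodePoly (input i)    ps = var i
nodePoly (gate o l r) ps = ⟦ o ⟧op (lookup ps l) (lookup ps r)

dagPolys : ∀ {N k} → DAG N k → Vec (Poly N) k
dagPolys []      = []
dagPolys (ν ∷ G) = nodePoly ν (dagPolys G) ∷ dagPolys G

produced : ∀ {N} → Circuit N → Poly N
produced (circuit G o) = lookup (dagPolys G) o

gates : ∀ {N k} → DAG N k → ℕ
gates []               = 0
gates (input _    ∷ G) = gates G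
gates (gate _ _ _ ∷ G) = suc (gates G)

size : ∀ {N} → Circuit N → ℕ
size (circuit G _) = gates G

_Counts_ : ∀ {N} → Circuit N → Poly N → Set
_Counts_ {N} C f = (a : Vec Bool N) → produced C at a ≡ f at a

_Decides_ : ∀ {N} → Circuit N → Poly N → Set
_Decides_ {N} C f = (a : Vec Bool N) → (produced C at a ≡ 0) ⇔ (f at a ≡ 0)

IsMinimumSize : ∀ {N} → (Circuit N → Set) → ℕ → Set
IsMinimumSize {N} P s =
  (∃[ C ] P C × size C ≡ s) × ((C : Circuit N) → P C → s ≤ size C)

-- These are relations and not functions because some polynomials (for
-- example 0) are produced by no circuit, so that the minimum need not exist.
C₀₁[_]≡_ : ∀ {N} → Poly N → ℕ → Set
C₀₁[ f ]≡ s = IsMinimumSize (_Counts f) s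

D[_]≡_ : ∀ {N} → Poly N → ℕ → Set
D[ f ]≡ s = IsMinimumSize (_Decides f) s

vectors : {A : Set} → List A → (k : ℕ) → List (Vec A k)
vectors xs zero    = List.[ [] ]
vectors xs (suc k) = List.cartesianProductWith _∷_ xs (vectors xs k)

-- A map h from Fin n to itself is given by the vector of its values.
IsPermutation : ∀ {n} → Vec (Fin n) n → Set
IsPermutation h = Bijective _≡_ _≡_ (lookup h)

isPermutation? : ∀ {n} (h : Vec (Fin n) n) → Dec (IsPermutation h)
isPermutation? h = injective? ×-dec surjective?
  where
  injective? : Dec (Injective _≡_ _≡_ (lookup h))
  injective? = map′ (λ p {i} {j} → p i j) (λ p i j → p {i} {j})
    (all? λ i → all? λ j → (lookup h i ≟ lookup h j) →-dec (i ≟ j))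

  surjective? : Dec (Surjective _≡_ _≡_ (lookup h))
  surjective? = map′ strictlySurjective⇒surjective surjective⇒strictlySurjective
    (all? λ j → any? λ i → lookup h i ≟ j)

permutations : (n : ℕ) → List (Vec (Fin n) n)
permutations n = List.filter isPermutation? (vectors (List.allFin n) n)

x : ∀ {n} → Fin n → Fin n → Poly (n * n)
x i j = var (combine i j)

Per : (n : ℕ) → Poly (n * n)
Per n = ∑ (permutations n) λ h → ∏ (List.allFin n) λ i → x i (lookup h i)

Per+Sum : (n : ℕ) → Poly (n * n)
Per+Sum n = Per n ⊕ ∑ (List.allFin n) λ i → ∑ (List.allFin n) λ j → x i j

-- g n ≥ 2^(c n) for all large n, where c = p / q > 0.  Restricting c to
-- rational values is harmless, since a real constant can be decreased.
_Is2^Ω[n] : (ℕ → ℕ) → Set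
g Is2^Ω[n] = ∃[ p ] ∃[ q ] ∃[ n₀ ] NonZero p × NonZero q ×
  (∀ n → n₀ ≤ n → 2 ^ (p * n) ≤ g n ^ q)

{-# OPTIONS --safe #-}
-- The sum of all variables vanishes at the same 0/1 points as f, so it decides f.
--
-- Counting on 0/1 inputs determines which supports occur among the monomials.
-- So if F counts f, every monomial of F is supported on a partial matching,
-- and every permutation π is the support of some monomial of F.  Descending
-- from the output to the factor touching more columns, until at most 2t = 2n/3
-- columns are touched, assigns to π a gate q, a monomial s of q and a
-- cofactor c with s c supported on π and q c contained in F.  If π₀ with s₀ c₀
-- is assigned to the same gate, then s₀ c and s c₀ are matchings too, and this
-- forces π to map the rows of s₀ onto the columns of s₀.  As t < |s₀| ≤ 2t,
-- only a fraction 2^-t of all permutations do that, so there are at least 2^t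
-- gates.
module Submission where

open import Defs
open import Data.Bool.Base using (Bool; true; false; not; if_then_else_; T)
open import Data.Bool.Properties using (¬-not; ⇔→≡) renaming (_≟_ to _≟ᵇ_)
open import Data.Fin.Base using (Fin; zero; suc; combine; punchIn)
open import Data.Fin.Permutation as Perm
  using (Permutation′; _⟨$⟩ʳ_; _⟨$⟩ˡ_; inverseˡ; inverseʳ; insert; insert-punchIn)
open import Data.Fin.Properties as Fin using (any?; combine-injective; combine-surjective)
open import Data.List.Base as List using (List; []; _∷_; length)
open import Data.List.Membership.Propositional using (_∈_; lose; find)
open import Data.List.Membership.Propositional.Properties 
  using (∈-cartesianProductWith⁺; ∈-cartesianProductWith⁻; ∈-allFin; ∈-++⁺ˡ; ∈-++⁺ʳ; ∈-++⁻; ∈-filter⁺; ∈-filter⁻)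
open import Data.List.Properties using (++-identityʳ; map-++; length-tabulate)
open import Data.List.Relation.Unary.All as All using (All; []; _∷_)
open import Data.List.Relation.Unary.Any as Any using (Any; here; there)
open import Data.Nat.Base
open import Data.Nat.Combinatorics using (k![n∸k]!∣n!)
open import Data.Nat.Divisibility using (∣⇒≤)
open import Data.Nat.DivMod using (_/_; _%_; m≡m%n+[m/n]*n; m%n<n; m/n*n≤m; m≥n⇒m/n>0)
import Data.Nat.ListAction as ListAction
open import Data.Nat.ListAction.Properties using (sum-++)
open import Data.Nat.Properties
open import Algebra.Properties.Semiring.Sum +-*-semiring
  using (sum; sum-remove; ∑-distrib-+; sum-cong-≗; *-distribʳ-sum; sum-replicate-zero)
open import Data.Nat.Tactic.RingSolver using (solve-∀)
open import Data.Product.Base using (_×_; _,_; ∃₂; ∃-syntax; proj₁; proj₂)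
open import Data.Sum.Base as ⊎ using (_⊎_; inj₁; inj₂; [_,_]′)
open import Data.Vec.Base as Vec using (Vec; []; _∷_; lookup)
open import Data.Vec.Properties
  using (zipWith-identityʳ; zipWith-assoc; zipWith-comm; lookup-zipWith; lookup-map;
         lookup-replicate; lookup∘tabulate; lookup∘update; lookup∘update′)
open import Function.Base using (_∘_; id)
open import Function.Bundles using (_⇔_; mk⇔; Equivalence)
open import Function.Consequences.Propositional using (strictlySurjective⇒surjective)
open import Relation.Binary.PropositionalEquality
open import Relation.Nullary.Decidable
  using (Dec; yes; no; does; map′; _×-dec_; _→-dec_; decidable-stable; ¬¬-excluded-middle; dec-true)
open import Relation.Nullary.Negation using (contradiction; ¬_)
open import Relation.Unary using (Decidable)

open Equivalence using (to; from)

-- Minimum size and upper bounds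

module _ {N : ℕ} where

  inputsFrom : ∀ {k} → (Fin k → Fin N) → DAG N k
  inputsFrom {zero}  f = []
  inputsFrom {suc k} f = input (f zero) ∷ inputsFrom (f ∘ suc)

  lookup-inputsFrom : ∀ {k} (f : Fin k → Fin N) i → lookup (dagPolys (inputsFrom f)) i ≡ var (f i)
  lookup-inputsFrom f zero    = refl
  lookup-inputsFrom f (suc i) = lookup-inputsFrom (f ∘ suc) i

  gates-inputsFrom : ∀ {k} (f : Fin k → Fin N) → gates (inputsFrom f) ≡ 0
  gates-inputsFrom {zero}  f = refl
  gates-inputsFrom {suc k} f = gates-inputsFrom (f ∘ suc)

  gateNode : ∀ {k} → Op → Fin k × Fin k → Node N k
  gateNode o (l , r) = gate o l r

  gateNodes : ∀ k → List (Node N k)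
  gateNodes k = List.cartesianProductWith gateNode (plus ∷ times ∷ [])
    (List.cartesianProduct (List.allFin k) (List.allFin k))

  -- Repeated inputs make the circuits with s gates infinite in number, but
  -- it suffices to consider those that begin with one input per variable.
  normalDAGs : ∀ s → List (DAG N (s + N))
  normalDAGs zero    = inputsFrom id ∷ []
  normalDAGs (suc s) = List.cartesianProductWith _∷_ (gateNodes (s + N)) (normalDAGs s)

  ∈-gateNodes : ∀ {k} o (l r : Fin k) → gate o l r ∈ gateNodes k
  ∈-gateNodes o l r = ∈-cartesianProductWith⁺ gateNode (∈-ops o)
    (∈-cartesianProductWith⁺ _,_ (∈-allFin l) (∈-allFin r))
    where
    ∈-ops : ∀ o → o ∈ plus ∷ times ∷ []
    ∈-ops plus  = here refl
    ∈-ops times = there (here refl)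

  gates-normalDAGs : ∀ s {G} → G ∈ normalDAGs s → gates G ≡ s
  gates-normalDAGs zero    (here refl) = gates-inputsFrom id
  gates-normalDAGs (suc s) G∈
    with ν , G , ν∈ , G∈′ , refl ← ∈-cartesianProductWith⁻ _∷_ (gateNodes (s + N)) (normalDAGs s) G∈
    with _ , _ , _ , _ , refl ← ∈-cartesianProductWith⁻ gateNode (plus ∷ times ∷ [])
           (List.cartesianProduct (List.allFin (s + N)) (List.allFin (s + N))) ν∈
    = cong suc (gates-normalDAGs s G∈′)

  _⊑_ : ∀ {k k′} → DAG N k → DAG N k′ → Set
  _⊑_ {k} {k′} G G′ = ∀ i → ∃[ i′ ] lookup (dagPolys G′) i′ ≡ lookup (dagPolys G) i

  -- An input node is dropped, because every normal circuit already contains its variable; a gate is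
  -- kept and its references are redirected.
  normalise : ∀ {k} (G : DAG N k) → ∃[ G′ ] G′ ∈ normalDAGs (gates G) × G ⊑ G′
  normalise [] = inputsFrom id , here refl , λ ()
  normalise (input i ∷ G) with G′ , G′∈ , emb ← normalise G = G′ , G′∈ , emb′
    where
    variable-available : ∀ s {H} → H ∈ normalDAGs s → ∃[ j ] lookup (dagPolys H) j ≡ var i
    variable-available zero (here refl) = i , lookup-inputsFrom id i
    variable-available (suc s) H∈
      with _ , _ , _ , H∈′ , refl ← ∈-cartesianProductWith⁻ _∷_ (gateNodes (s + N)) (normalDAGs s) H∈
      with j , eq ← variable-available s H∈′ = suc j , eq
    emb′ : (input i ∷ G) ⊑ G′
    emb′ zero    = variable-available (gates G) G′∈
    emb′ (suc j) = emb j
  normalise (gate o l r ∷ G) with G′ , G′∈ , emb ← normalise G =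
    gate o (proj₁ (emb l)) (proj₁ (emb r)) ∷ G′
    , ∈-cartesianProductWith⁺ _∷_ (∈-gateNodes o _ _) G′∈
    , λ { zero    → zero , cong₂ ⟦ o ⟧op (proj₂ (emb l)) (proj₂ (emb r))
        ; (suc i) → suc (proj₁ (emb i)) , proj₂ (emb i) }

least : ∀ {P : ℕ → Set} → Decidable P → ∀ n → P n → ∃[ m ] P m × (∀ k → P k → m ≤ k)
least P? n Pn with P? 0
least P? n       Pn | yes P0 = 0 , P0 , λ _ _ → z≤n
least P? zero    Pn | no ¬P0 = contradiction Pn ¬P0
least P? (suc n) Pn | no ¬P0 with m , Pm , min ← least (P? ∘ suc) n Pn =
  suc m , Pm , λ { zero P0 → contradiction P0 ¬P0 ; (suc k) Pk → s≤s (min k Pk) }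

module _ {N : ℕ} {P : Poly N → Set} (P? : Decidable P) where

  -- The finitely many normal circuits with `s` gates realise every polynomial that `s` gates can
  -- produce, so a finite search suffices.
  sizeRealised? : Decidable (λ s → ∃[ C ] P (produced {N} C) × size C ≡ s)
  sizeRealised? s = map′ realised normalised
    (Any.any? (λ G → any? λ o → P? (lookup (dagPolys G) o)) (normalDAGs s))
    where
    OutputIn : ∀ {k} → DAG N k → Set
    OutputIn G = ∃[ o ] P (lookup (dagPolys G) o)
    realised : Any OutputIn (normalDAGs s) → ∃[ C ] P (produced C) × size C ≡ s
    realised G∈ with G , G∈′ , o , p ← find G∈ = circuit G o , p , gates-normalDAGs s G∈′
    normalised : ∃[ C ] P (produced C) × size C ≡ s → Any OutputIn (normalDAGs s)
    normalised (circuit G o , p , refl) with G′ , G′∈ , emb ← normalise G =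
      lose G′∈ (proj₁ (emb o) , subst P (sym (proj₂ (emb o))) p)

  minimumSize : (C : Circuit N) → P (produced C) →
    ∃[ s ] IsMinimumSize (P ∘ produced) s × s ≤ size C
  minimumSize C p with s , ex , min ← least sizeRealised? (size C) (C , p , refl) =
    s , (ex , λ C′ p′ → min (size C′) (C′ , p′ , refl)) , min (size C) (C , p , refl)

module _ {N : ℕ} where

  -- Quantifying over a circuit `G` to be extended makes constructions compose: whatever `G`
  -- produces stays available to later gates.
  ComputableWith : ℕ → Poly N → Set
  ComputableWith g p = ∀ {k} (G : DAG N k) → ∃₂ λ k′ (G′ : DAG N k′) →
    gates G′ ≡ gates G + g × G ⊑ G′ × ∃[ o ] lookup (dagPolys G′) o ≡ p

  computable-var : ∀ i → ComputableWith 0 (var i)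
  computable-var i G = _ , input i ∷ G , sym (+-identityʳ _) , (λ j → suc j , refl) , zero , refl

  computable-op : ∀ o {g h p q} → ComputableWith g p → ComputableWith h q →
    ComputableWith (g + suc h) (⟦ o ⟧op p q)
  computable-op o {g} {h} P Q G
    with _ , G₁ , s₁ , emb₁ , l , eq₁ ← P G
    with _ , G₂ , s₂ , emb₂ , r , eq₂ ← Q G₁ =
    _ , gate o (proj₁ (emb₂ l)) r ∷ G₂
    , size-eq
    , (λ i → suc (proj₁ (emb₂ (proj₁ (emb₁ i)))) , trans (proj₂ (emb₂ _)) (proj₂ (emb₁ i)))
    , zero , cong₂ ⟦ o ⟧op (trans (proj₂ (emb₂ l)) eq₁) eq₂
    where
    size-eq : suc (gates G₂) ≡ gates G + (g + suc h)
    size-eq = begin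
      suc (gates G₂)         ≡⟨ cong suc s₂ ⟩
      suc (gates G₁ + h)     ≡⟨ +-suc (gates G₁) h ⟨
      gates G₁ + suc h       ≡⟨ cong (_+ suc h) s₁ ⟩
      gates G + g + suc h    ≡⟨ +-assoc (gates G) g (suc h) ⟩
      gates G + (g + suc h)  ∎
      where open ≡-Reasoning

  module _ {A : Set} {t : A → Poly N} {g : ℕ} where

    -- No circuit produces the empty sum, hence the separate first term. The remaining `length xs`
    -- terms cost `g` gates and one addition each.
    computable-∑ : (∀ x → ComputableWith g (t x)) → ∀ x xs →
      ComputableWith (g + length xs * suc g) (∑ (x ∷ xs) t)
    computable-∑ T x [] =
      subst₂ ComputableWith (sym (+-identityʳ g)) (sym (++-identityʳ (t x))) (T x)
    computable-∑ T x (y ∷ ys) =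
      computable-op plus (T x) (computable-∑ T y ys)

    computable-∏ : (∀ x → ComputableWith g (t x)) → ∀ x xs →
      ComputableWith (g + length xs * suc g) (∏ (x ∷ xs) t)
    computable-∏ T x [] =
      subst₂ ComputableWith (sym (+-identityʳ g)) (sym (⊗-identityʳ (t x))) (T x)
      where
      ⊗-identityʳ : ∀ p → p ⊗ 𝟙 ≡ p
      ⊗-identityʳ []      = refl
      ⊗-identityʳ (e ∷ p) = cong₂ _∷_ (zipWith-identityʳ +-identityʳ e) (⊗-identityʳ p)
    computable-∏ T x (y ∷ ys) =
      computable-op times (T x) (computable-∏ T y ys)

  minimumSize-computable : ∀ {P : Poly N → Set} → Decidable P → ∀ {g p} → ComputableWith g p → P p →
    ∃[ s ] IsMinimumSize (P ∘ produced) s × s ≤ g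
  minimumSize-computable P? T Pp with _ , G , refl , _ , o , refl ← T [] =
    minimumSize P? (circuit G o) Pp

-- Supports of monomials

support : ∀ {N} → Monomial N → Vec Bool N
support = Vec.map (0 <ᵇ_)

module _ {N : ℕ} where

  -- At 0/1 points all positive exponents of the first variable act alike, so the exponent can be
  -- forgotten once the monomials are separated.
  zeroPart posPart : Poly (suc N) → Poly N
  zeroPart []                = []
  zeroPart ((zero  ∷ e) ∷ p) = e ∷ zeroPart p
  zeroPart ((suc _ ∷ e) ∷ p) = zeroPart p
  posPart []                = []
  posPart ((zero  ∷ e) ∷ p) = posPart p
  posPart ((suc _ ∷ e) ∷ p) = e ∷ posPart p

  at-false : ∀ p (a : Vec Bool N) → p at (false ∷ a) ≡ zeroPart p at a
  at-false []                a = refl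
  at-false ((zero  ∷ e) ∷ p) a = cong₂ _+_ (*-identityˡ _) (at-false p a)
  at-false ((suc _ ∷ e) ∷ p) a = at-false p a

  at-true : ∀ p (a : Vec Bool N) → p at (true ∷ a) ≡ zeroPart p at a + posPart p at a
  at-true []                a = refl
  at-true ((zero  ∷ e) ∷ p) a =
    trans (cong₂ _+_ (*-identityˡ _) (at-true p a))
      (sym (+-assoc (evalMonomial e (Vec.map bit a)) (zeroPart p at a) (posPart p at a)))
  at-true ((suc d ∷ e) ∷ p) a = begin
    1 ^ suc d * v + p at (true ∷ a)  ≡⟨ cong (λ u → u * v + p at (true ∷ a)) (^-zeroˡ (suc d)) ⟩
    1 * v + p at (true ∷ a)          ≡⟨ cong₂ _+_ (*-identityˡ v) (at-true p a) ⟩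
    v + (z + w)                      ≡⟨ +-assoc v z w ⟨
    v + z + w                        ≡⟨ cong (_+ w) (+-comm v z) ⟩
    z + v + w                        ≡⟨ +-assoc z v w ⟩
    z + (v + w)                      ∎
    where
    open ≡-Reasoning
    v = evalMonomial e (Vec.map bit a)
    z = zeroPart p at a
    w = posPart p at a

  ∈-zeroPart⁺ : ∀ {p e} → (zero ∷ e) ∈ p → e ∈ zeroPart p
  ∈-zeroPart⁺ (here refl) = here refl
  ∈-zeroPart⁺ {(zero  ∷ _) ∷ _} (there i) = there (∈-zeroPart⁺ i)
  ∈-zeroPart⁺ {(suc _ ∷ _) ∷ _} (there i) = ∈-zeroPart⁺ i

  ∈-posPart⁺ : ∀ {p d e} → (suc d ∷ e) ∈ p → e ∈ posPart p
  ∈-posPart⁺ (here refl) = here refl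
  ∈-posPart⁺ {(zero  ∷ _) ∷ _} (there i) = ∈-posPart⁺ i
  ∈-posPart⁺ {(suc _ ∷ _) ∷ _} (there i) = there (∈-posPart⁺ i)

  ∈-zeroPart⁻ : ∀ p {e} → e ∈ zeroPart p → (zero ∷ e) ∈ p
  ∈-zeroPart⁻ ((zero  ∷ e) ∷ p) (here refl) = here refl
  ∈-zeroPart⁻ ((zero  ∷ e) ∷ p) (there i)   = there (∈-zeroPart⁻ p i)
  ∈-zeroPart⁻ ((suc _ ∷ e) ∷ p) i           = there (∈-zeroPart⁻ p i)

  ∈-posPart⁻ : ∀ p {e} → e ∈ posPart p → ∃[ d ] (suc d ∷ e) ∈ p
  ∈-posPart⁻ ((zero  ∷ e) ∷ p) i           = _ , there (proj₂ (∈-posPart⁻ p i))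
  ∈-posPart⁻ ((suc _ ∷ e) ∷ p) (here refl) = _ , here refl
  ∈-posPart⁻ ((suc _ ∷ e) ∷ p) (there i)   = _ , there (proj₂ (∈-posPart⁻ p i))

-- On 0/1 inputs a polynomial only depends on the supports of its monomials,
-- and conversely its values determine the number of monomials of each support.
same-supports : ∀ {N} (p q : Poly N) → (∀ a → p at a ≡ q at a) →
  ∀ {m} → m ∈ p → ∃[ m′ ] m′ ∈ q × support m′ ≡ support m
-- Without variables the value is the number of monomials, so `q` cannot be empty if `p` is not.
same-supports {zero} ([] ∷ _) []      p≗q m∈p with () ← p≗q []
same-supports {zero} p ([] ∷ q) p≗q {[]} m∈p = [] , here refl , refl
same-supports {suc N} p q p≗q {zero ∷ e} m∈p =
  let e′ , e′∈ , eq = same-supports (zeroPart p) (zeroPart q) zero-agree (∈-zeroPart⁺ m∈p)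
  in zero ∷ e′ , ∈-zeroPart⁻ q e′∈ , cong (false ∷_) eq
  where
  zero-agree : ∀ a → zeroPart p at a ≡ zeroPart q at a
  zero-agree a = trans (sym (at-false p a)) (trans (p≗q (false ∷ a)) (at-false q a))
same-supports {suc N} p q p≗q {suc d ∷ e} m∈p =
  let e′ , e′∈ , eq = same-supports (posPart p) (posPart q) pos-agree (∈-posPart⁺ m∈p)
      d′ , m′∈ = ∈-posPart⁻ q e′∈
  in suc d′ ∷ e′ , m′∈ , cong (true ∷_) eq
  where
  pos-agree : ∀ a → posPart p at a ≡ posPart q at a
  -- The values of `posPart` are the increments when the first coordinate rises from 0 to 1.
  pos-agree a = +-cancelˡ-≡ (p at (false ∷ a)) _ _ (begin
    p at (false ∷ a) + posPart p at a   ≡⟨ cong (_+ posPart p at a) (at-false p a) ⟩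
    zeroPart p at a + posPart p at a    ≡⟨ at-true p a ⟨
    p at (true ∷ a)                     ≡⟨ p≗q (true ∷ a) ⟩
    q at (true ∷ a)                     ≡⟨ at-true q a ⟩
    zeroPart q at a + posPart q at a    ≡⟨ cong (_+ posPart q at a) (at-false q a) ⟨
    q at (false ∷ a) + posPart q at a   ≡⟨ cong (_+ posPart q at a) (p≗q (false ∷ a)) ⟨
    p at (false ∷ a) + posPart q at a   ∎)
    where open ≡-Reasoning

infixl 7 _·_

_·_ : ∀ {N} → Monomial N → Monomial N → Monomial N
_·_ = Vec.zipWith _+_

support-resp : ∀ {N} {m m′ : Monomial N} → support m ≡ support m′ →
  ∀ k → 0 < lookup m k → 0 < lookup m′ k
support-resp {m = m} {m′} eq k 0<m = <ᵇ⇒< 0 _ (subst T same-entry (<⇒<ᵇ 0<m))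
  where
  same-entry : (0 <ᵇ lookup m k) ≡ (0 <ᵇ lookup m′ k)
  same-entry = trans (sym (lookup-map k (0 <ᵇ_) m))
    (trans (cong (λ v → lookup v k) eq) (lookup-map k (0 <ᵇ_) m′))

module _ {N : ℕ} where

  pos-·⁻ : ∀ (d e : Monomial N) k → 0 < lookup (d · e) k → 0 < lookup d k ⊎ 0 < lookup e k
  pos-·⁻ d e k 0<de rewrite lookup-zipWith _+_ k d e with lookup d k
  ... | zero  = inj₂ 0<de
  ... | suc _ = inj₁ z<s

  pos-·ˡ : ∀ (d e : Monomial N) k → 0 < lookup d k → 0 < lookup (d · e) k
  pos-·ˡ d e k 0<d rewrite lookup-zipWith _+_ k d e = ≤-trans 0<d (m≤m+n _ _)

  pos-·ʳ : ∀ (d e : Monomial N) k → 0 < lookup e k → 0 < lookup (d · e) k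
  pos-·ʳ d e k 0<e rewrite lookup-zipWith _+_ k d e = ≤-trans 0<e (m≤n+m _ _)

  unit : Fin N → Monomial N
  unit i = Vec.replicate N 0 Vec.[ i ]≔ 1

  pos-unit⁻ : ∀ i k → 0 < lookup (unit i) k → i ≡ k
  pos-unit⁻ i k 0<u with i Fin.≟ k
  ... | yes i≡k = i≡k
  ... | no  i≢k = contradiction
    (subst (0 <_) (trans (lookup∘update′ (i≢k ∘ sym) (Vec.replicate N 0) 1) (lookup-replicate k 0)) 0<u) λ ()

  pos-unit⁺ : ∀ i → 0 < lookup (unit i) i
  pos-unit⁺ i = ≤-reflexive (sym (lookup∘update i (Vec.replicate N 0) 1))

  pos-replicate : ∀ k → ¬ 0 < lookup (Vec.replicate N 0) k
  pos-replicate k 0<r = contradiction (subst (0 <_) (lookup-replicate k 0) 0<r) λ ()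

  module _ {A : Set} {t : A → Poly N} where

    ∈-∑⁺ : ∀ {x xs m} → x ∈ xs → m ∈ t x → m ∈ ∑ xs t
    ∈-∑⁺ (here refl)         m∈ = ∈-++⁺ˡ m∈
    ∈-∑⁺ {xs = y ∷ _} (there x∈) m∈ = ∈-++⁺ʳ (t y) (∈-∑⁺ x∈ m∈)

    ∈-∑⁻ : ∀ xs {m} → m ∈ ∑ xs t → ∃[ x ] x ∈ xs × m ∈ t x
    ∈-∑⁻ (x ∷ xs) m∈ with ∈-++⁻ (t x) m∈
    ... | inj₁ m∈t = x , here refl , m∈t
    ... | inj₂ m∈∑ with y , y∈ , m∈t ← ∈-∑⁻ xs m∈∑ = y , there y∈ , m∈t

  module _ {A : Set} (g : A → Fin N) where

    product-monomial : ∀ xs → ∃[ m ] m ∈ ∏ xs (var ∘ g)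
    product-monomial []       = _ , here refl
    product-monomial (x ∷ xs) =
      _ , ∈-cartesianProductWith⁺ _·_ {xs = var (g x)} (here refl) (proj₂ (product-monomial xs))

    pos-∏⁺ : ∀ xs {m x} → m ∈ ∏ xs (var ∘ g) → x ∈ xs → 0 < lookup m (g x)
    pos-∏⁺ (y ∷ xs) m∈ x∈
      with _ , e , here refl , e∈ , refl ← ∈-cartesianProductWith⁻ _·_ (var (g y)) (∏ xs (var ∘ g)) m∈
      with x∈
    ... | here refl = pos-·ˡ (unit (g y)) e (g y) (pos-unit⁺ (g y))
    ... | there x∈′ = pos-·ʳ (unit (g y)) e _ (pos-∏⁺ xs e∈ x∈′)

    pos-∏⁻ : ∀ xs {m k} → m ∈ ∏ xs (var ∘ g) → 0 < lookup m k → ∃[ x ] g x ≡ k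
    pos-∏⁻ [] (here refl) 0<m = contradiction 0<m (pos-replicate _)
    pos-∏⁻ (y ∷ xs) {k = k} m∈ 0<m
      with _ , e , here refl , e∈ , refl ← ∈-cartesianProductWith⁻ _·_ (var (g y)) (∏ xs (var ∘ g)) m∈
      with pos-·⁻ (unit (g y)) e k 0<m
    ... | inj₁ 0<u = y , pos-unit⁻ (g y) k 0<u
    ... | inj₂ 0<e = pos-∏⁻ xs e∈ 0<e

-- 0 ^ 0 = 1, so a monomial vanishes at a 0/1 point only if the point is 0 at
-- a variable of positive exponent.
evalMonomial-zero : ∀ {N} (m : Monomial N) a k → 0 < lookup m k → lookup a k ≡ false →
  evalMonomial m (Vec.map bit a) ≡ 0
evalMonomial-zero (suc _ ∷ m) (false ∷ a) zero    0<m refl = refl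
evalMonomial-zero (d ∷ m)     (b ∷ a)     (suc k) 0<m eq   =
  trans (cong (bit b ^ d *_) (evalMonomial-zero m a k 0<m eq)) (*-zeroʳ (bit b ^ d))

evalMonomial-one : ∀ {N} (m : Monomial N) a → (∀ k → 0 < lookup m k → lookup a k ≡ true) →
  evalMonomial m (Vec.map bit a) ≡ 1
evalMonomial-one []          []          _ = refl
evalMonomial-one (zero  ∷ m) (b ∷ a)     h =
  trans (*-identityˡ _) (evalMonomial-one m a (h ∘ suc))
evalMonomial-one (suc d ∷ m) (b ∷ a)     h with refl ← h zero z<s =
  cong₂ _*_ (^-zeroˡ (suc d)) (evalMonomial-one m a (h ∘ suc))

evalMonomial≤at : ∀ {N} {p : Poly N} {m} a → m ∈ p → evalMonomial m (Vec.map bit a) ≤ p at a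
evalMonomial≤at a (here refl) = m≤m+n _ _
evalMonomial≤at {p = e ∷ p} a (there m∈) =
  ≤-trans (evalMonomial≤at a m∈) (m≤n+m _ (evalMonomial e (Vec.map bit a)))

at-zero : ∀ {N} (p : Poly N) a → (∀ {m} → m ∈ p → evalMonomial m (Vec.map bit a) ≡ 0) → p at a ≡ 0
at-zero []      a h = refl
at-zero (e ∷ p) a h = cong₂ _+_ (h (here refl)) (at-zero p a (h ∘ there))

at-⊕ : ∀ {N} (p q : Poly N) a → (p ⊕ q) at a ≡ p at a + q at a
at-⊕ p q a = trans (cong ListAction.sum (map-++ _ p q)) (sum-++ (List.map _ p) _)

-- Decomposing monomials along a circuit

gatePolys : ∀ {N k} → DAG N k → List (Poly N)
gatePolys []              = []
gatePolys (input _ ∷ G)   = gatePolys G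
gatePolys (gate o l r ∷ G) = nodePoly (gate o l r) (dagPolys G) ∷ gatePolys G

length-gatePolys : ∀ {N k} (G : DAG N k) → length (gatePolys G) ≡ gates G
length-gatePolys []               = refl
length-gatePolys (input _ ∷ G)    = length-gatePolys G
length-gatePolys (gate _ _ _ ∷ G) = cong suc (length-gatePolys G)

-- `μ` will be the number of columns touched. It depends on supports only, as it must: 0/1 values do
-- not control the exponents in `F`.
module Descent {N : ℕ} (F : Poly N) (μ : Monomial N → ℕ)
  (μ-· : ∀ d e → μ (d · e) ≤ μ d + μ e) (μ-unit : ∀ i → μ (unit i) ≤ 1)
  (t : ℕ) (1≤t : 1 ≤ t) where

  -- All monomials of `q` have to fit with `c`, not only the one met in the descent. This lets two
  -- permutations assigned to the same gate exchange their cofactors.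
  Complement : Poly N → Monomial N → Set
  Complement q c = ∀ {s} → s ∈ q → s · c ∈ F

  record Splits (m : Monomial N) (q : Poly N) : Set where
    constructor splits
    field
      {inner outer} : Monomial N
      inner∈     : inner ∈ q
      complement : Complement q outer
      recompose  : inner · outer ≡ m
      lower      : t < μ inner
      upper      : μ inner ≤ t + t

  -- From a gate whose monomial has measure above 2t, a sum passes the monomial
  -- on to one input, and a product has a factor of measure above t; the other
  -- factor is moved into the complement.
  descend : ∀ {k} (G : DAG N k) o {s c} → s ∈ lookup (dagPolys G) o →
    Complement (lookup (dagPolys G) o) c → t < μ s → Any (Splits (s · c)) (gatePolys G)
  descend (input _ ∷ G)    (suc o) s∈ C t<s = descend G o s∈ C t<s
  descend (gate _ _ _ ∷ G) (suc o) s∈ C t<s = there (descend G o s∈ C t<s)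
  -- A variable has measure at most 1 ≤ t, so the descent stops at a gate.
  descend (input i ∷ G) zero (here refl) C t<s =
    contradiction (≤-trans (μ-unit i) 1≤t) (<⇒≱ t<s)
  descend (gate o l r ∷ G) zero {s} {c} s∈ C t<s with μ s ≤? t + t
  ... | yes s≤2t = here (splits s∈ C refl t<s s≤2t)
  descend (gate plus l r ∷ G) zero s∈ C t<s | no _ with ∈-++⁻ (lookup (dagPolys G) l) s∈
  ... | inj₁ s∈l = there (descend G l s∈l (C ∘ ∈-++⁺ˡ) t<s)
  ... | inj₂ s∈r = there (descend G r s∈r (C ∘ ∈-++⁺ʳ _) t<s)
  descend (gate times l r ∷ G) zero {c = c} s∈ C t<s | no s≰2t
    with d , e , d∈ , e∈ , refl ←
           ∈-cartesianProductWith⁻ _·_ (lookup (dagPolys G) l) (lookup (dagPolys G) r) s∈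
    with t <? μ d | t <? μ e
  ... | yes t<d | _ = there (subst (λ m → Any (Splits m) _) (sym (assoc d e c))
          (descend G l d∈
            (λ {d′} d′∈ → subst (_∈ F) (assoc d′ e c) (C (∈-cartesianProductWith⁺ _·_ d′∈ e∈))) t<d))
    where
    assoc : ∀ (a b c : Monomial N) → a · b · c ≡ a · (b · c)
    assoc = zipWith-assoc +-assoc
  ... | no _ | yes t<e = there (subst (λ m → Any (Splits m) _) (sym (swap d e c))
          (descend G r e∈
            (λ {e′} e′∈ → subst (_∈ F) (swap d e′ c) (C (∈-cartesianProductWith⁺ _·_ d∈ e′∈))) t<e))
    where
    swap : ∀ (a b c : Monomial N) → a · b · c ≡ b · (a · c)
    swap a b c = trans (cong (_· c) (zipWith-comm +-comm a b)) (zipWith-assoc +-assoc b a c)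
  ... | no t≮d | no t≮e =
    contradiction (≤-trans (μ-· d e) (+-mono-≤ (≮⇒≥ t≮d) (≮⇒≥ t≮e))) s≰2t

-- Permutations avoiding prescribed images of sets

sum-mono-≤ : ∀ {n} {f g : Fin n → ℕ} → (∀ i → f i ≤ g i) → sum f ≤ sum g
sum-mono-≤ {zero}  f≤g = z≤n
sum-mono-≤ {suc n} f≤g = +-mono-≤ (f≤g zero) (sum-mono-≤ (f≤g ∘ suc))

n*k≤sum : ∀ {n k} {f : Fin n → ℕ} → (∀ i → k ≤ f i) → n * k ≤ sum f
n*k≤sum {zero}  k≤f = z≤n
n*k≤sum {suc n} k≤f = +-mono-≤ (k≤f zero) (n*k≤sum (k≤f ∘ suc))

∣_∣ : ∀ {n} → (Fin n → Bool) → ℕ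
∣ C ∣ = sum (bit ∘ C)

∣C∣-remove : ∀ {n} (C : Fin (suc n) → Bool) j {b} → C j ≡ b → ∣ C ∣ ≡ bit b + ∣ C ∘ punchIn j ∣
∣C∣-remove C j refl = sum-remove {i = j} (bit ∘ C)

∣C∣+∣¬C∣ : ∀ {n} (C : Fin n → Bool) → ∣ C ∣ + ∣ not ∘ C ∣ ≡ n
∣C∣+∣¬C∣ {zero}  C = refl
∣C∣+∣¬C∣ {suc n} C with C zero
... | true  = cong suc (∣C∣+∣¬C∣ (C ∘ suc))
... | false = trans (+-suc ∣ C ∘ suc ∣ _) (cong suc (∣C∣+∣¬C∣ (C ∘ suc)))

∣C∣≡0 : ∀ {n} (C : Fin n → Bool) → (∀ i → C i ≢ true) → ∣ C ∣ ≡ 0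
∣C∣≡0 {zero}  C C≢ = refl
∣C∣≡0 {suc n} C C≢ with C zero in eq
... | true  = contradiction eq (C≢ zero)
... | false = ∣C∣≡0 (C ∘ suc) (C≢ ∘ suc)

∣C∣≤1 : ∀ {n} (C : Fin n → Bool) → (∀ i j → C i ≡ true → C j ≡ true → i ≡ j) → ∣ C ∣ ≤ 1
∣C∣≤1 {zero}  C unique = z≤n
∣C∣≤1 {suc n} C unique with C zero in eq
... | true  = s≤s (≤-reflexive (∣C∣≡0 (C ∘ suc) λ i Ci → contradiction (unique zero (suc i) eq Ci) λ ()))
... | false = ∣C∣≤1 (C ∘ suc) λ i j Ci Cj → Fin.suc-injective (unique (suc i) (suc j) Ci Cj)

∣C∣≡n : ∀ {n} (C : Fin n → Bool) → (∀ i → C i ≡ true) → ∣ C ∣ ≡ n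
∣C∣≡n {zero}  C all = refl
∣C∣≡n {suc n} C all rewrite all zero = cong suc (∣C∣≡n (C ∘ suc) (all ∘ suc))

-- The number of permutations π with R i = C (π i) for all i.
matches : ∀ n → (Fin n → Bool) → (Fin n → Bool) → ℕ
matches zero    R C = 1
matches (suc n) R C = sum λ j →
  if does (C j ≟ᵇ R zero) then matches n (R ∘ suc) (C ∘ punchIn j) else 0

-- With d columns of value `b` there are d choices for the image of the first row, and each leaves d
-- - 1 such columns. `K` accounts for the columns of the other value, which all remain.
matches-step : ∀ {n} (C : Fin (suc n) → Bool) b (v : Fin (suc n) → ℕ) K →
  (∀ j → C j ≡ b → v j ≤ ∣ (λ i → does (C (punchIn j i) ≟ᵇ b)) ∣ ! * K) →
  sum (λ j → if does (C j ≟ᵇ b) then v j else 0) ≤ ∣ (λ j → does (C j ≟ᵇ b)) ∣ ! * K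
matches-step {n} C b v K v≤ = begin
  sum (λ j → if D j then v j else 0)      ≤⟨ sum-mono-≤ term ⟩
  sum (λ j → bit (D j) * (pred d ! * K))  ≡⟨ *-distribʳ-sum (pred d ! * K) (bit ∘ D) ⟨
  d * (pred d ! * K)                      ≡⟨ *-assoc d (pred d !) K ⟨
  d * pred d ! * K                        ≤⟨ *-monoˡ-≤ K (n*pred-n!≤n! d) ⟩
  d ! * K                                 ∎
  where
  open ≤-Reasoning
  D : Fin (suc n) → Bool
  D j = does (C j ≟ᵇ b)
  d = ∣ D ∣
  n*pred-n!≤n! : ∀ k → k * pred k ! ≤ k !
  n*pred-n!≤n! zero    = z≤n
  n*pred-n!≤n! (suc k) = ≤-refl
  term : ∀ j → (if D j then v j else 0) ≤ bit (D j) * (pred d ! * K)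
  term j with C j ≟ᵇ b in eq
  ... | no  _    = z≤n
  ... | yes Cj≡b = begin
    v j                          ≤⟨ v≤ j Cj≡b ⟩
    ∣ D ∘ punchIn j ∣ ! * K      ≡⟨ cong (λ k → pred k ! * K) (∣C∣-remove D j (cong does eq)) ⟨
    pred d ! * K                 ≡⟨ *-identityˡ (pred d ! * K) ⟨
    1 * (pred d ! * K)           ∎

does-true : ∀ b → does (b ≟ᵇ true) ≡ b
does-true true  = refl
does-true false = refl

does-false : ∀ b → does (b ≟ᵇ false) ≡ not b
does-false true  = refl
does-false false = refl

∣C∣-cong : ∀ {n} {C D : Fin n → Bool} → (∀ i → C i ≡ D i) → ∣ C ∣ ≡ ∣ D ∣
∣C∣-cong C≗D = sum-cong-≗ (cong bit ∘ C≗D)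

-- The first row uses up a column of its own value and leaves the other class intact. The bound is
-- attained when `R` and `C` have equal cardinality; otherwise the count is 0.
matches≤ : ∀ n R C → matches n R C ≤ ∣ C ∣ ! * ∣ not ∘ C ∣ !
matches≤ zero    R C = ≤-refl
matches≤ (suc n) R C with R zero
... | true = begin
  sum (λ j → if does (C j ≟ᵇ true) then w j else 0)
    ≤⟨ matches-step C true w (∣ not ∘ C ∣ !) step ⟩
  ∣ (λ j → does (C j ≟ᵇ true)) ∣ ! * ∣ not ∘ C ∣ !
    ≡⟨ cong (λ k → k ! * ∣ not ∘ C ∣ !) (∣C∣-cong (does-true ∘ C)) ⟩
  ∣ C ∣ ! * ∣ not ∘ C ∣ ! ∎
  where
  open ≤-Reasoning
  w : Fin (suc n) → ℕ
  w j = matches n (R ∘ suc) (C ∘ punchIn j)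
  step : ∀ j → C j ≡ true → w j ≤ ∣ (λ i → does (C (punchIn j i) ≟ᵇ true)) ∣ ! * ∣ not ∘ C ∣ !
  step j Cj = ≤-trans (matches≤ n (R ∘ suc) (C ∘ punchIn j)) (≤-reflexive (cong₂ (λ k l → k ! * l !)
    (sym (∣C∣-cong (does-true ∘ C ∘ punchIn j))) (sym (∣C∣-remove (not ∘ C) j (cong not Cj)))))
... | false = begin
  sum (λ j → if does (C j ≟ᵇ false) then w j else 0)
    ≤⟨ matches-step C false w (∣ C ∣ !) step ⟩
  ∣ (λ j → does (C j ≟ᵇ false)) ∣ ! * ∣ C ∣ !
    ≡⟨ cong (λ k → k ! * ∣ C ∣ !) (∣C∣-cong (does-false ∘ C)) ⟩
  ∣ not ∘ C ∣ ! * ∣ C ∣ !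
    ≡⟨ *-comm (∣ not ∘ C ∣ !) (∣ C ∣ !) ⟩
  ∣ C ∣ ! * ∣ not ∘ C ∣ ! ∎
  where
  open ≤-Reasoning
  w : Fin (suc n) → ℕ
  w j = matches n (R ∘ suc) (C ∘ punchIn j)
  step : ∀ j → C j ≡ false → w j ≤ ∣ (λ i → does (C (punchIn j i) ≟ᵇ false)) ∣ ! * ∣ C ∣ !
  step j Cj = ≤-trans (matches≤ n (R ∘ suc) (C ∘ punchIn j)) (≤-reflexive (trans
    (*-comm (∣ C ∘ punchIn j ∣ !) _) (cong₂ (λ k l → k ! * l !)
    (sym (∣C∣-cong (does-false ∘ C ∘ punchIn j))) (sym (∣C∣-remove C j Cj)))))

-- The method of conditional expectations: the image of 0 is chosen so that
-- the bound survives the removal of its row and column.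
avoid : ∀ {A : Set} n (R C : A → Fin n → Bool) (xs : List A) →
  ListAction.sum (List.map (λ a → matches n (R a) (C a)) xs) < n ! →
  ∃[ π ] (∀ {a} → a ∈ xs → ¬ (∀ i → R a i ≡ C a (π ⟨$⟩ʳ i)))
avoid zero    R C []       _ = Perm.id , λ ()
avoid zero    R C (a ∷ xs) (s≤s ())
avoid {A} (suc n) R C xs W<n! = step (any? λ j → total xs j <? n !)
  where
  open ≤-Reasoning
  w : Fin (suc n) → A → ℕ
  w j a = matches n (R a ∘ suc) (C a ∘ punchIn j)

  selected : List A → Fin (suc n) → List A
  selected ys j = List.filter (λ a → C a j ≟ᵇ R a zero) ys

  total : List A → Fin (suc n) → ℕ
  total ys j = ListAction.sum (List.map (w j) (selected ys j))

  -- Exchange of summation: a pattern contributes to the columns that it admits as image of the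
  -- first row, and these contributions add up to its `matches` by definition.
  averaging : ∀ ys → sum (total ys) ≡
    ListAction.sum (List.map (λ a → matches (suc n) (R a) (C a)) ys)
  averaging []       = sum-replicate-zero (suc n)
  averaging (a ∷ ys) = begin-equality
    sum (total (a ∷ ys))                                  ≡⟨ sum-cong-≗ split ⟩
    sum (λ j → chosen j + total ys j)                     ≡⟨ ∑-distrib-+ chosen (total ys) ⟩
    matches (suc n) (R a) (C a) + sum (total ys)          ≡⟨ cong (matches (suc n) (R a) (C a) +_) (averaging ys) ⟩
    ListAction.sum (List.map (λ a → matches (suc n) (R a) (C a)) (a ∷ ys)) ∎
    where
    chosen : Fin (suc n) → ℕ
    chosen j = if does (C a j ≟ᵇ R a zero) then w j a else 0
    split : ∀ j → total (a ∷ ys) j ≡ chosen j + total ys j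
    split j with does (C a j ≟ᵇ R a zero)
    ... | true  = refl
    ... | false = refl

  step : Dec (∃[ j ] total xs j < n !) → _
  -- If each of the n + 1 columns had total at least n!, the whole weight would reach (n + 1)!.
  step (no ∄) = contradiction W<n! (≤⇒≯ (begin
    suc n * n !                         ≤⟨ n*k≤sum (λ j → ≮⇒≥ (λ lt → ∄ (j , lt))) ⟩
    sum (total xs)  ≡⟨ averaging xs ⟩
    _                                   ∎))
  step (yes (j , lt)) with π , avoids ← avoid n (λ a → R a ∘ suc) (λ a → C a ∘ punchIn j) (selected xs j) lt =
    -- Patterns outside `selected` are already violated at index 0; the others are left to `π`.
    insert zero j π , λ {a} a∈ agree →
      avoids (∈-filter⁺ (λ a → C a j ≟ᵇ R a zero) a∈ (sym (agree zero)))
        λ i → trans (agree (suc i)) (cong (C a) (insert-punchIn zero j π i))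

-- The binomial coefficient of k + l over k is at least 2^t: raising both k and l by 1 multiplies it
-- by (k+l+2)(k+l+1) / ((k+1)(l+1)), which is at least 2.
k!*l!*2^t≤[k+l]! : ∀ t k l → t ≤ k → t ≤ l → k ! * l ! * 2 ^ t ≤ (k + l) !
k!*l!*2^t≤[k+l]! zero k l _ _ = begin
  k ! * l ! * 1          ≡⟨ *-identityʳ _ ⟩
  k ! * l !              ≡⟨ cong (λ h → k ! * h !) (m+n∸m≡n k l) ⟨
  k ! * (k + l ∸ k) !    ≤⟨ ∣⇒≤ {{(k + l) !≢0}} (k![n∸k]!∣n! (m≤m+n k l)) ⟩
  (k + l) !              ∎
  where open ≤-Reasoning
k!*l!*2^t≤[k+l]! (suc t) (suc k) (suc l) (s≤s t≤k) (s≤s t≤l) = begin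
  suc k * k ! * (suc l * l !) * (2 * 2 ^ t)       ≡⟨ regroup k l (k !) (l !) (2 ^ t) ⟩
  suc k * suc l * 2 * (k ! * l ! * 2 ^ t)         ≤⟨ *-mono-≤ factors (k!*l!*2^t≤[k+l]! t k l t≤k t≤l) ⟩
  suc (suc (k + l)) * suc (k + l) * (k + l) !     ≡⟨ *-assoc (suc (suc (k + l))) (suc (k + l)) _ ⟩
  (suc (suc (k + l))) !                           ≡⟨ cong (λ h → suc h !) (+-suc k l) ⟨
  (suc k + suc l) !                               ∎
  where
  open ≤-Reasoning
  regroup : ∀ k l p q r → suc k * p * (suc l * q) * (2 * r) ≡ suc k * suc l * 2 * (p * q * r)
  regroup = solve-∀
  expand : ∀ k l → suc (suc (k + l)) * suc (k + l) ≡ suc k * suc l * 2 + (k * k + l * l + k + l)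
  expand = solve-∀
  factors : suc k * suc l * 2 ≤ suc (suc (k + l)) * suc (k + l)
  factors = subst (suc k * suc l * 2 ≤_) (sym (expand k l)) (m≤m+n _ _)

-- Permutations and matchings as monomials

∈-vectors : ∀ {A : Set} {xs : List A} {k} (v : Vec A k) → (∀ i → lookup v i ∈ xs) → v ∈ vectors xs k
∈-vectors []      _  = here refl
∈-vectors (y ∷ v) v∈ = ∈-cartesianProductWith⁺ _∷_ (v∈ zero) (∈-vectors v (v∈ ∘ suc))

allPoints? : ∀ {N} {P : Vec Bool N → Set} → Decidable P → Dec (∀ a → P a)
allPoints? {N} P? = map′
  (λ ps a → All.lookup ps (∈-vectors a (λ i → ∈-bools (lookup a i))))
  (λ p → All.tabulate (λ {a} _ → p a))
  (All.all? P? (vectors (false ∷ true ∷ []) N))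
  where
  ∈-bools : ∀ b → b ∈ false ∷ true ∷ []
  ∈-bools false = here refl
  ∈-bools true  = there (here refl)

does-true⁻ : ∀ {P : Set} (P? : Dec P) → does P? ≡ true → P
does-true⁻ (yes p) _ = p

module _ {n : ℕ} where

  perm-injective : ∀ (π : Permutation′ n) {i j} → π ⟨$⟩ʳ i ≡ π ⟨$⟩ʳ j → i ≡ j
  perm-injective π eq = trans (sym (inverseˡ π)) (trans (cong (π ⟨$⟩ˡ_) eq) (inverseˡ π))

  -- A record, because i and j cannot be inferred from combine i j.
  record Pos (m : Monomial (n * n)) (i j : Fin n) : Set where
    constructor pos
    field
      positive : 0 < lookup m (combine i j)

  open Pos public

  pos? : ∀ m i j → Dec (Pos m i j)
  pos? m i j = map′ pos positive (0 <? lookup m (combine i j))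

  pos-·-⊎ : ∀ {d e i j} → Pos (d · e) i j → Pos d i j ⊎ Pos e i j
  pos-·-⊎ {d} {e} (pos p) = ⊎.map pos pos (pos-·⁻ d e _ p)

  pos-inˡ : ∀ {d e i j} → Pos d i j → Pos (d · e) i j
  pos-inˡ {d} {e} (pos p) = pos (pos-·ˡ d e _ p)

  pos-inʳ : ∀ {d e i j} → Pos e i j → Pos (d · e) i j
  pos-inʳ {d} {e} (pos p) = pos (pos-·ʳ d e _ p)

  Graph : Monomial (n * n) → (Fin n → Fin n) → Set
  Graph m h = ∀ i j → Pos m i j ⇔ h i ≡ j

  Matching : Monomial (n * n) → Set
  Matching m = ∀ {i j i′ j′} → Pos m i j → Pos m i′ j′ → i ≡ i′ ⇔ j ≡ j′

  graph-pos : ∀ {m h} → Graph m h → ∀ i → Pos m i (h i)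
  graph-pos G i = from (G i _) refl

  graph-matching : ∀ {m h} → (∀ {i j} → h i ≡ h j → i ≡ j) → Graph m h → Matching m
  graph-matching {h = h} inj G p p′ with refl ← to (G _ _) p | refl ← to (G _ _) p′ = mk⇔ (cong h) inj

  graph-∏ : ∀ {m} (h : Fin n → Fin n) → m ∈ ∏ (List.allFin n) (λ i → x i (h i)) → Graph m h
  graph-∏ {m} h m∈ i j = mk⇔ to′ from′
    where
    g : Fin n → Fin (n * n)
    g i = combine i (h i)
    to′ : Pos m i j → h i ≡ j
    to′ (pos p) with i′ , eq ← pos-∏⁻ g (List.allFin n) m∈ p
      with refl , eq′ ← combine-injective i′ (h i′) i j eq = eq′
    from′ : h i ≡ j → Pos m i j
    from′ refl = pos (pos-∏⁺ g (List.allFin n) m∈ (∈-allFin i))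

  ∈-Per⁻ : ∀ {m} → m ∈ Per n → ∃[ h ] IsPermutation h × Graph m (lookup h)
  ∈-Per⁻ m∈ with h , h∈ , m∈∏ ← ∈-∑⁻ (permutations n) m∈ =
    h , proj₂ (∈-filter⁻ isPermutation? {xs = vectors (List.allFin n) n} h∈) , graph-∏ (lookup h) m∈∏

  permutationVector : (π : Permutation′ n) → Vec (Fin n) n
  permutationVector π = Vec.tabulate (π ⟨$⟩ʳ_)

  ∈-permutations : (π : Permutation′ n) → permutationVector π ∈ permutations n
  ∈-permutations π = ∈-filter⁺ isPermutation? (∈-vectors (permutationVector π) (λ i → ∈-allFin _))
    ( (λ {i} {j} eq → perm-injective π (trans (sym (value i)) (trans eq (value j))))
    , strictlySurjective⇒surjective (λ j → π ⟨$⟩ˡ j , trans (value _) (inverseʳ π)))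
    where
    value : ∀ i → lookup (permutationVector π) i ≡ π ⟨$⟩ʳ i
    value = lookup∘tabulate (π ⟨$⟩ʳ_)

  permutation-monomial : (π : Permutation′ n) → ∃[ m ] m ∈ Per n × Graph m (π ⟨$⟩ʳ_)
  permutation-monomial π
    with m , m∈ ← product-monomial (λ i → combine i (lookup (permutationVector π) i)) (List.allFin n) =
    m , ∈-∑⁺ (∈-permutations π) m∈
    , λ i j → subst (λ k → Pos m i j ⇔ k ≡ j) (lookup∘tabulate (π ⟨$⟩ʳ_) i)
        (graph-∏ (lookup (permutationVector π)) m∈ i j)

  Per+Sum-matching : ∀ {m} → m ∈ Per+Sum n → Matching m
  Per+Sum-matching m∈ with ∈-++⁻ (Per n) m∈
  ... | inj₁ m∈Per with h , (inj , _) , G ← ∈-Per⁻ m∈Per = graph-matching inj G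
  ... | inj₂ m∈Sum
    with i , _ , m∈′ ← ∈-∑⁻ (List.allFin n) m∈Sum
    with j , _ , here refl ← ∈-∑⁻ (List.allFin n) m∈′ =
    λ p p′ → at-unit (pos-unit⁻ _ _ (positive p)) (pos-unit⁻ _ _ (positive p′))
    where
    at-unit : ∀ {i₁ j₁ i₂ j₂} →
      combine i j ≡ combine i₁ j₁ → combine i j ≡ combine i₂ j₂ → i₁ ≡ i₂ ⇔ j₁ ≡ j₂
    at-unit {i₁} {j₁} {i₂} {j₂} eq₁ eq₂
      with refl , refl ← combine-injective i j i₁ j₁ eq₁
      with refl , refl ← combine-injective i j i₂ j₂ eq₂ = mk⇔ (λ _ → refl) (λ _ → refl)

  rowUsed? : ∀ m i → Dec (∃[ j ] Pos m i j)
  rowUsed? m i = any? λ j → pos? m i j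

  colUsed? : ∀ m j → Dec (∃[ i ] Pos m i j)
  colUsed? m j = any? λ i → pos? m i j

  rows cols : Monomial (n * n) → Fin n → Bool
  rows m i = does (rowUsed? m i)
  cols m j = does (colUsed? m j)

  ∣cols∣-· : ∀ d e → ∣ cols (d · e) ∣ ≤ ∣ cols d ∣ + ∣ cols e ∣
  ∣cols∣-· d e = ≤-trans (sum-mono-≤ column) (≤-reflexive (∑-distrib-+ (bit ∘ cols d) (bit ∘ cols e)))
    where
    column : ∀ j → bit (cols (d · e) j) ≤ bit (cols d j) + bit (cols e j)
    column j with colUsed? (d · e) j | colUsed? d j | colUsed? e j
    ... | no _            | _     | _     = z≤n
    ... | yes _           | yes _ | _     = s≤s z≤n
    ... | yes _           | no _  | yes _ = s≤s z≤n
    ... | yes (i , p)     | no ¬d | no ¬e =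
      contradiction (pos-·-⊎ p) [ (λ q → ¬d (i , q)) , (λ q → ¬e (i , q)) ]′

  ∣cols∣-unit : ∀ k → ∣ cols (unit k) ∣ ≤ 1
  ∣cols∣-unit k = ∣C∣≤1 (cols (unit k)) λ j j′ c c′ →
    let i  , pos p  = does-true⁻ (colUsed? (unit k) j) c
        i′ , pos p′ = does-true⁻ (colUsed? (unit k) j′) c′
    in proj₂ (combine-injective i j i′ j′ (trans (sym (pos-unit⁻ k _ p)) (pos-unit⁻ k _ p′)))

  ∣cols∣-graph : ∀ {m} (π : Permutation′ n) → Graph m (π ⟨$⟩ʳ_) → ∣ cols m ∣ ≡ n
  ∣cols∣-graph {m} π G = ∣C∣≡n (cols m) λ j →
    dec-true (colUsed? m j) (π ⟨$⟩ˡ j , from (G _ _) (inverseʳ π))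

  -- An entry of the permutation π occurs in s or in c, and each of s and c is
  -- consistent with the complementary part of π₀.
  cross : ∀ {s c s₀ c₀} (π π₀ : Permutation′ n) →
    Graph (s · c) (π ⟨$⟩ʳ_) → Graph (s₀ · c₀) (π₀ ⟨$⟩ʳ_) →
    Matching (s · c₀) → Matching (s₀ · c) →
    ∀ i → rows s₀ i ≡ cols s₀ (π ⟨$⟩ʳ i)
  cross {s} {c} {s₀} {c₀} π π₀ G G₀ M M₀ i =
    ⇔→≡ (mk⇔ (λ r → dec-true (colUsed? s₀ (π ⟨$⟩ʳ i)) (col (does-true⁻ (rowUsed? s₀ i) r)))
             (λ c → dec-true (rowUsed? s₀ i) (row (does-true⁻ (colUsed? s₀ (π ⟨$⟩ʳ i)) c))))
    where
    M₀₀ : Matching (s₀ · c₀)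
    M₀₀ = graph-matching (perm-injective π₀) G₀
    col : ∃[ j ] Pos s₀ i j → ∃[ i′ ] Pos s₀ i′ (π ⟨$⟩ʳ i)
    col (j , p₀) with pos-·-⊎ (graph-pos G i)
    -- The entry of `π` in row `i` lies in `c` and shares its row with `p₀`, so the matching
    -- `s₀ · c` makes their columns equal.
    ... | inj₂ p with refl ← to (M₀ (pos-inˡ p₀) (pos-inʳ p)) refl = i , p₀
    ... | inj₁ p with pos-·-⊎ (from (G₀ (π₀ ⟨$⟩ˡ (π ⟨$⟩ʳ i)) _) (inverseʳ π₀))
    ...   | inj₁ q = _ , q
    -- The entry of `π₀` in column `π ⟨$⟩ʳ i` lies in `c₀`. By `s · c₀` its row is `i`, and then
    -- `s₀ · c₀` puts `p₀` into that column too.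
    ...   | inj₂ q
      with q′ ← subst (λ k → Pos c₀ k (π ⟨$⟩ʳ i)) (sym (from (M (pos-inˡ p) (pos-inʳ q)) refl)) q
      with refl ← to (M₀₀ (pos-inˡ p₀) (pos-inʳ q′)) refl = i , p₀
    row : ∃[ i′ ] Pos s₀ i′ (π ⟨$⟩ʳ i) → ∃[ j ] Pos s₀ i j
    row (i′ , p₀) with pos-·-⊎ (graph-pos G i)
    ... | inj₂ p with refl ← from (M₀ (pos-inˡ p₀) (pos-inʳ p)) refl = _ , p₀
    ... | inj₁ p with pos-·-⊎ (graph-pos G₀ i)
    ...   | inj₁ q = _ , q
    -- By `s · c₀`, `π` and `π₀` agree at `i`; then `s₀ · c₀` has entries in rows `i` and `i′` of
    -- one column, so the rows coincide.
    ...   | inj₂ q = _ , subst (λ k → Pos s₀ k (π ⟨$⟩ʳ i))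
              (from (M₀₀ (pos-inˡ p₀) (pos-inʳ q))
                    (to (M (pos-inˡ p) (pos-inʳ q)) refl)) p₀

support-matching : ∀ {n} {m m′ : Monomial (n * n)} → support m ≡ support m′ →
  Matching {n} m → Matching {n} m′
support-matching {m = m} {m′} eq M (pos p) (pos p′) =
  M (pos (support-resp {m = m′} {m} (sym eq) _ p)) (pos (support-resp {m = m′} {m} (sym eq) _ p′))

support-graph : ∀ {n} {m m′ : Monomial (n * n)} {h} → support m ≡ support m′ →
  Graph {n} m h → Graph {n} m′ h
support-graph {m = m} {m′} eq G i j =
  mk⇔ (λ p → to (G i j) (pos (support-resp {m = m′} {m} (sym eq) _ (positive p))))
      (λ h≡j → pos (support-resp {m = m} {m′} eq _ (positive (from (G i j) h≡j))))

-- The lower bound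

module LowerBound (n t : ℕ) (1≤t : 1 ≤ t) (3t≤n : t + (t + t) ≤ n)
  (C : Circuit (n * n)) (counts : C Counts Per+Sum n) where

  open Circuit C

  F : Poly (n * n)
  F = produced C

  F-matching : ∀ {m} → m ∈ F → Matching {n} m
  F-matching m∈ with m′ , m′∈ , eq ← same-supports F (Per+Sum n) counts m∈ =
    support-matching eq (Per+Sum-matching m′∈)

  F-permutation : (π : Permutation′ n) → ∃[ m ] m ∈ F × Graph {n} m (π ⟨$⟩ʳ_)
  F-permutation π
    with m , m∈ , G ← permutation-monomial π
    with m′ , m′∈ , eq ← same-supports (Per+Sum n) F (sym ∘ counts) (∈-++⁺ˡ m∈) =
    m′ , m′∈ , support-graph (sym eq) G

  open Descent F (∣_∣ ∘ cols {n}) (∣cols∣-· {n}) (∣cols∣-unit {n}) t 1≤t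

  t<n : t < n
  t<n = <-≤-trans (m<m+n t (≤-trans 1≤t (m≤m+n t t))) 3t≤n

  permutation-splits : (π : Permutation′ n) →
    ∃[ m ] Graph {n} m (π ⟨$⟩ʳ_) × Any (Splits m) (gatePolys dag)
  permutation-splits π with m , m∈ , G ← F-permutation π =
    m , G , subst (λ e → Any (Splits e) (gatePolys dag)) (·-identityʳ m)
      -- The descent starts at the output with cofactor 1; the monomial of a permutation touches all
      -- n > t columns.
      (descend dag output m∈ (λ {s} s∈ → subst (_∈ F) (sym (·-identityʳ s)) s∈)
        (<-≤-trans t<n (≤-reflexive (sym (∣cols∣-graph π G)))))
    where
    ·-identityʳ : ∀ e → e · Vec.replicate _ 0 ≡ e
    ·-identityʳ = zipWith-identityʳ +-identityʳ

  Pattern : Set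
  Pattern = (Fin n → Bool) × (Fin n → Bool)

  Respects : Permutation′ n → Pattern → Set
  Respects π (R , C) = ∀ i → R i ≡ C (π ⟨$⟩ʳ i)

  weight : Pattern → ℕ
  weight (R , C) = matches n R C

  pattern-of : ∀ {m q} → Splits m q → Pattern
  pattern-of sp = rows {n} (Splits.inner sp) , cols {n} (Splits.inner sp)

  -- As t < |K| ≤ 2t and 3t ≤ n, both `K` and its complement have at least t columns, so the
  -- binomial estimate applies.
  pattern-weight : ∀ {m q} (sp : Splits m q) → weight (pattern-of sp) * 2 ^ t ≤ n !
  pattern-weight sp = begin
    weight (pattern-of sp) * 2 ^ t          ≤⟨ *-monoˡ-≤ (2 ^ t) (matches≤ n (rows {n} s) K) ⟩
    ∣ K ∣ ! * ∣ not ∘ K ∣ ! * 2 ^ t         ≤⟨ k!*l!*2^t≤[k+l]! t _ _ (<⇒≤ (Splits.lower sp)) t≤∣¬K∣ ⟩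
    (∣ K ∣ + ∣ not ∘ K ∣) !                 ≡⟨ cong _! (∣C∣+∣¬C∣ K) ⟩
    n !                                     ∎
    where
    open ≤-Reasoning
    s = Splits.inner sp
    K = cols {n} s
    t≤∣¬K∣ : t ≤ ∣ not ∘ K ∣
    t≤∣¬K∣ = +-cancelʳ-≤ (t + t) _ _ (begin
      t + (t + t)             ≤⟨ 3t≤n ⟩
      n                       ≡⟨ ∣C∣+∣¬C∣ K ⟨
      ∣ K ∣ + ∣ not ∘ K ∣     ≡⟨ +-comm ∣ K ∣ _ ⟩
      ∣ not ∘ K ∣ + ∣ K ∣     ≤⟨ +-monoʳ-≤ _ (Splits.upper sp) ⟩
      ∣ not ∘ K ∣ + (t + t)   ∎)

  -- Both inner monomials belong to the same `q`, so each combines with the other's cofactor to a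
  -- monomial of `F`, which is a matching.
  pattern-respected : ∀ {m m₀ q π π₀} → Graph {n} m (π ⟨$⟩ʳ_) → Graph {n} m₀ (π₀ ⟨$⟩ʳ_) →
    Splits m q → (sp₀ : Splits m₀ q) → Respects π (pattern-of sp₀)
  pattern-respected {π = π} {π₀} G G₀ (splits s∈ c∁ refl _ _) (splits s₀∈ c₀∁ refl _ _) =
    cross π π₀ G G₀ (F-matching (c₀∁ s∈)) (F-matching (c∁ s₀∈))

  -- One pattern per gate is enough: any single permutation assigned to the gate supplies a pattern
  -- that all permutations assigned there respect.
  record Cover (Q : List (Poly (n * n))) : Set where
    field
      patterns : List Pattern
      few      : length patterns ≤ length Q
      light    : All (λ P → weight P * 2 ^ t ≤ n !) patterns
      covers   : ∀ {π m} → Graph {n} m (π ⟨$⟩ʳ_) → Any (Splits m) Q → Any (Respects π) patterns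

  -- Whether some permutation splits at `q` is not decided, so the case distinction is made under
  -- double negation. The final inequality is decidable, which removes it again.
  ¬¬cover : ∀ Q → ¬ ¬ Cover Q
  ¬¬cover []      ¬cover = ¬cover record { patterns = [] ; few = z≤n ; light = [] ; covers = λ _ () }
  ¬¬cover (q ∷ Q) ¬cover = ¬¬cover Q λ c → ¬¬-excluded-middle
    {A = ∃₂ λ π m → Graph {n} m (π ⟨$⟩ʳ_) × Splits m q} λ
    { (yes (π₀ , m₀ , G₀ , sp₀)) → ¬cover record
        { patterns = pattern-of sp₀ ∷ Cover.patterns c
        ; few      = s≤s (Cover.few c)
        ; light    = pattern-weight sp₀ ∷ Cover.light c
        ; covers   = λ { {π} G (here sp) → here (pattern-respected {π = π} {π₀} G G₀ sp sp₀)
                       ; {π} G (there any) → there (Cover.covers c {π} G any) } }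
    ; (no ∄) → ¬cover record
        { patterns = Cover.patterns c
        ; few      = ≤-trans (Cover.few c) (n≤1+n _)
        ; light    = Cover.light c
        ; covers   = λ { {π} {m} G (here sp) → contradiction (π , m , G , sp) ∄
                       ; {π} G (there any) → Cover.covers c {π} G any } } }

  total-weight : ∀ {Ps} → All (λ P → weight P * 2 ^ t ≤ n !) Ps →
    ListAction.sum (List.map weight Ps) * 2 ^ t ≤ length Ps * n !
  total-weight []       = z≤n
  total-weight {P ∷ Ps} (l ∷ ls) =
    ≤-trans (≤-reflexive (*-distribʳ-+ (2 ^ t) (weight P) _)) (+-mono-≤ l (total-weight ls))

  -- With fewer than 2^t gates the patterns weigh less than n! in total, so some permutation
  -- respects none of them, although the descent assigns it to a gate.
  bound : 2 ^ t ≤ size C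
  bound = decidable-stable (2 ^ t ≤? size C) λ small → ¬¬cover (gatePolys dag) λ c →
    let open Cover c
        π , avoids = avoid n proj₁ proj₂ patterns (*-cancelʳ-< (2 ^ t) _ (n !) (begin-strict
          ListAction.sum (List.map weight patterns) * 2 ^ t  ≤⟨ total-weight light ⟩
          length patterns * n !                               ≤⟨ *-monoˡ-≤ (n !) few ⟩
          length (gatePolys dag) * n !                        ≡⟨ cong (_* n !) (length-gatePolys dag) ⟩
          size C * n !                                        <⟨ *-monoˡ-< (n !) {{n !≢0}} (≰⇒> small) ⟩
          2 ^ t * n !                                         ≡⟨ *-comm (2 ^ t) (n !) ⟩
          n ! * 2 ^ t                                         ∎))
        m , G , any = permutation-splits π
        P , P∈ , respects = find (covers {π} G any)
    in avoids P∈ respects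
    where open ≤-Reasoning

-- Existence of the minima and the two bounds for f

Sum : ∀ n → Poly (n * n)
Sum n = ∑ (List.allFin n) λ i → ∑ (List.allFin n) λ j → x i j

module _ {n : ℕ} where

  unit∈Sum : ∀ i j → unit (combine i j) ∈ Sum n
  unit∈Sum i j = ∈-∑⁺ {t = λ i → ∑ (List.allFin n) (x i)} (∈-allFin i)
    (∈-∑⁺ {t = x i} (∈-allFin j) (here refl))

  Sum-vanishes : ∀ a → Sum n at a ≡ 0 → ∀ k → lookup a k ≡ false
  Sum-vanishes a Sum≡0 k with i , j , refl ← combine-surjective {n} k = ¬-not λ aₖ≡true →
    contradiction (evalMonomial≤at {p = Sum n} a (unit∈Sum i j)) (<⇒≱ (≤-reflexive (trans (cong suc Sum≡0)
      (sym (evalMonomial-one (unit (combine i j)) a λ l p →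
        subst (λ l → lookup a l ≡ true) (pos-unit⁻ (combine i j) l p) aₖ≡true)))))

  -- Every monomial of the permanent has a variable from row `i`. For n = 0 there is no row and the
  -- permanent is 1.
  Per-vanishes : Fin n → ∀ a → (∀ k → lookup a k ≡ false) → Per n at a ≡ 0
  Per-vanishes i a a≡0 = at-zero (Per n) a λ {m} m∈ →
    let h , _ , G = ∈-Per⁻ {n} {m} m∈
    in evalMonomial-zero m a (combine i (lookup h i)) (positive (graph-pos {h = lookup h} G i)) (a≡0 _)

  Sum-decides : Fin n → ∀ a → Sum n at a ≡ 0 ⇔ Per+Sum n at a ≡ 0
  Sum-decides i a = mk⇔
    (λ Sum≡0 → trans (at-⊕ (Per n) (Sum n) a) (cong₂ _+_ (Per-vanishes i a (Sum-vanishes a Sum≡0)) Sum≡0))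
    (λ f≡0 → m+n≡0⇒n≡0 (Per n at a) (trans (sym (at-⊕ (Per n) (Sum n) a)) f≡0))

decides? : ∀ {N} (f : Poly N) → Decidable (λ p → ∀ a → p at a ≡ 0 ⇔ f at a ≡ 0)
decides? f p = allPoints? λ a → map′ (λ (f , g) → mk⇔ f g) (λ eqv → to eqv , from eqv)
  (((p at a ≟ 0) →-dec (f at a ≟ 0)) ×-dec ((f at a ≟ 0) →-dec (p at a ≟ 0)))

counts? : ∀ {N} (f : Poly N) → Decidable (λ p → ∀ a → p at a ≡ f at a)
counts? f p = allPoints? λ a → p at a ≟ f at a

module _ {N : ℕ} {f : Poly N} where

  D-exists : ∀ {g p} → ComputableWith g p → (∀ a → p at a ≡ 0 ⇔ f at a ≡ 0) →
    ∃[ d ] (D[ f ]≡ d) × d ≤ g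
  D-exists = minimumSize-computable (decides? f)

  C₀₁-exists : ∀ {g} → ComputableWith g f → ∃[ c ] (C₀₁[ f ]≡ c)
  C₀₁-exists T =
    let c , min , _ = minimumSize-computable (counts? f) T (λ _ → refl)
    in c , min

module _ (k : ℕ) where

  computable-∑-allFin : ∀ {N g} {t : Fin (suc k) → Poly N} →
    (∀ i → ComputableWith g (t i)) → ComputableWith (g + k * suc g) (∑ (List.allFin (suc k)) t)
  computable-∑-allFin {g = g} {t} T =
    subst (λ l → ComputableWith (g + l * suc g) (∑ (List.allFin (suc k)) t)) (length-tabulate {n = k} suc)
      (computable-∑ T zero (List.tabulate suc))

  sumGates : ℕ
  sumGates = k * 1 + k * suc (k * 1)

  computable-Sum : ComputableWith sumGates (Sum (suc k))
  computable-Sum = computable-∑-allFin {t = λ i → ∑ (List.allFin (suc k)) (x i)} λ i →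
    computable-∑-allFin {t = x i} λ j → computable-var (combine i j)

  sumGates≤ : sumGates ≤ suc k ^ 2
  -- With n = k + 1, adding n^2 variables takes n^2 - 1 gates; the 1 is the slack.
  sumGates≤ = subst (sumGates ≤_) (identity k) (m≤m+n _ 1)
    where
    identity : ∀ k → k * 1 + k * suc (k * 1) + 1 ≡ suc k * (suc k * 1)
    identity = solve-∀

  -- Expanding over all permutations gives some circuit from which the search for a least one can
  -- start. The identity witnesses that the sum is not empty.
  computable-Per : ∃[ g ] ComputableWith g (Per (suc k))
  computable-Per = nonempty (permutations (suc k)) (∈-permutations Perm.id)
    where
    t : Vec (Fin (suc k)) (suc k) → Poly (suc k * suc k)
    t h = ∏ (List.allFin (suc k)) λ i → x i (lookup h i)
    nonempty : ∀ hs {h} → h ∈ hs → ∃[ g ] ComputableWith g (∑ hs t)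
    nonempty (h ∷ hs) _ = _ , computable-∑ {t = t}
      (λ h → computable-∏ {t = λ i → x i (lookup h i)} (λ i → computable-var (combine i (lookup h i)))
               zero (List.tabulate suc))
      h hs

  D-minimum : ∃[ d ] (D[ Per+Sum (suc k) ]≡ d) × d ≤ suc k ^ 2
  D-minimum =
    let d , min , d≤ = D-exists {f = Per+Sum (suc k)} computable-Sum (Sum-decides {suc k} zero)
    in d , min , ≤-trans d≤ sumGates≤

  C₀₁-minimum : ∃[ c ] (C₀₁[ Per+Sum (suc k) ]≡ c)
  C₀₁-minimum = C₀₁-exists {f = Per+Sum (suc k)}
    (computable-op plus {p = Per (suc k)} {q = Sum (suc k)} (proj₂ computable-Per) computable-Sum)

-- For n = 0 there are no variables and hence no circuits; the value 0 is a placeholder.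
C₀₁-choice : ∀ n → ∃[ c ] (NonZero n → C₀₁[ Per+Sum n ]≡ c)
C₀₁-choice zero    = 0 , λ ()
C₀₁-choice (suc k) = let c , min = C₀₁-minimum k in c , λ _ → min

2^n≤c^5 : ∀ {n c} → 3 ≤ n → C₀₁[ Per+Sum n ]≡ c → 2 ^ n ≤ c ^ 5
2^n≤c^5 {n} 3≤n ((C , counts , refl) , _) = begin
  2 ^ n              ≤⟨ ^-monoʳ-≤ 2 n≤t*5 ⟩
  2 ^ (t * 5)        ≡⟨ ^-*-assoc 2 t 5 ⟨
  (2 ^ t) ^ 5        ≤⟨ ^-monoˡ-≤ 5 (LowerBound.bound n t 1≤t 3t≤n C counts) ⟩
  size C ^ 5         ∎
  where
  open ≤-Reasoning
  t = n / 3
  1≤t : 1 ≤ t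
  1≤t = m≥n⇒m/n>0 3≤n
  triple : ∀ t → t * 3 ≡ t + (t + t)
  triple = solve-∀
  3t≤n : t + (t + t) ≤ n
  3t≤n = subst (_≤ n) (triple t) (m/n*n≤m n 3)
  n≤t*5 : n ≤ t * 5
  -- The remainder is at most 2 ≤ 2t because t ≥ 1, which holds from n = 3 on. This is where the
  -- exponent 5 comes from.
  n≤t*5 = begin
    n                ≡⟨ m≡m%n+[m/n]*n n 3 ⟩
    n % 3 + t * 3    ≤⟨ +-monoˡ-≤ (t * 3) (≤-trans (s≤s⁻¹ (m%n<n n 3)) (*-monoˡ-≤ 2 1≤t)) ⟩
    t * 2 + t * 3    ≡⟨ *-distribˡ-+ t 2 3 ⟨
    t * 5            ∎

theorem3 : (∀ n → NonZero n → ∃[ d ] (D[ Per+Sum n ]≡ d) × d ≤ n ^ 2)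
    × (∃[ c ] (∀ n → NonZero n → C₀₁[ Per+Sum n ]≡ (c n)) × c Is2^Ω[n])
theorem3 = (λ { (suc k) _ → D-minimum k })
  , proj₁ ∘ C₀₁-choice
  , (λ n n≢0 → proj₂ (C₀₁-choice n) n≢0)
  , 1 , 5 , 3 , _ , _
  , λ n 3≤n → subst (λ e → 2 ^ e ≤ proj₁ (C₀₁-choice n) ^ 5) (sym (*-identityˡ n))
      (2^n≤c^5 3≤n (proj₂ (C₀₁-choice n) (>-nonZero (≤-trans z<s 3≤n))))
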